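{- Let $X$ be a normal modal logic and let $I$ be an index set with $\omega\subseteq I$. Suppose that $X$ is complete with respect to a set of Kripke frames $F=\{(G_\alpha,R_\alpha):\alpha\in I\}$, where for every $\alpha\in I$, $G_\alpha$ is a nonempty infinite set and $R_\alpha$ is an accessibility relation (a binary relation) on $G_\alpha$. Let $H=\{(G_i^*,R_i^*): i\in\omega\}$ be a set of Kripke frames such that for every $i\in\omega$: $$G_i^*=\{*,g_0,g_1,\dots,g_i\}\cup G_{\omega i},$$ where $G_{\omega i}=\{\eta_{ij}: j\in\omega\}$ has cardinality $\aleph_0$, $\{*,g_0,\dots,g_i\}\cap G_{\omega i}=\emptyset$, the elements $*,g_0,\dots,g_i$ are distinct, and $$R_i^*=\{(*,g_j):0\le j\le i\}\cup\{(g_j,g_k): j\ne k,\ 1\le j\le i,\ 1\le k\le i\}\cup\{(\eta,\eta):\eta\in G_{\omega i}\}.$$ If $H\subseteq F$, then $B$-translation is faithful with respect to $X$.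
   Context: The system $\mathbf{L_1}$ (Leśniewski's propositional ontology): fix a countably infinite set of name variables. The atomic formulas are exactly the expressions $\epsilon ab$ with $a,b$ name variables (possibly equal); formulas are built from atomic formulas by $\vee$ and $\neg$, the other connectives being the usual classical abbreviations. $\mathbf{L_1}$ is a Hilbert-style system of classical propositional logic (with modus ponens) over these formulas with the additional axiom schemata, for all name variables $a,b,c$: (Ax1) $\epsilon ab \supset \epsilon aa$; (Ax2) $(\epsilon ab \wedge \epsilon bc) \supset \epsilon ac$; (Ax3) $(\epsilon ab \wedge \epsilon bc) \supset \epsilon ba$. $B$-translation: to each name variable $a$ corresponds a propositional variable $p_a$, with distinct name variables corresponding to distinct propositional variables. $B$ maps formulas of $\mathbf{L_1}$ to propositional modal formulas by $B(\phi\vee\psi)=B(\phi)\vee B(\psi)$, $B(\neg\phi)=\neg B(\phi)$, $B(\epsilon ab)=p_a\wedge\Box(p_a\supset p_b)\wedge\bigl(p_b\supset\Box(p_b\supset p_a)\bigr)$. $B$-translation is faithful with respect to a modal logic $X$ if for every formula $\phi$ of $\mathbf{L_1}$, $\vdash_X B(\phi)$ implies $\vdash_{\mathbf{L_1}}\phi$. A normal modal logic is a set $X$ of propositional modal formulas with $\mathbf{K}\subseteq X$ that is closed under modus ponens, substitution and necessitation. $X$ is complete with respect to a set $F$ of Kripke frames if, for every modal formula $\chi$, $\vdash_X\chi$ holds if and only if $\chi$ is valid in every frame in $F$. -}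

module Defs where

open import Level using (Level; _⊔_; 0ℓ) renaming (suc to lsuc)
open import Data.Fin using (Fin; toℕ)
open import Data.Nat using (ℕ; suc; _≤_)
open import Data.Product using (∃-syntax)
open import Data.Sum using (_⊎_)
open import Function.Bundles using (Inverse; _↔_; _↣_; _⇔_; module Injection)
open import Relation.Binary using (Rel)
open import Relation.Binary.PropositionalEquality using (_≡_; _≢_)
open import Relation.Nullary using (¬_)
open import Relation.Unary using (Pred; _∈_; _⊆_)

private variable
  a ℓ : Level

-- The Hilbert–Ackermann schemata for classical logic with primitives ∨ and ¬
-- (modus ponens being the only rule), over any type of formulas closed under
-- these two connectives.
module Classical {Form : Set} (_∨_ : Form → Form → Form) (∼_ : Form → Form) where

  infixr 6 _∧_
  infixr 4 _⊃_

  _⊃_ : Form → Form → Form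
  φ ⊃ ψ = (∼ φ) ∨ ψ

  _∧_ : Form → Form → Form
  φ ∧ ψ = ∼ ((∼ φ) ∨ (∼ ψ))

  data Axiom : Pred Form 0ℓ where
    taut : ∀ φ     → Axiom ((φ ∨ φ) ⊃ φ)
    add  : ∀ φ ψ   → Axiom (φ ⊃ (φ ∨ ψ))
    perm : ∀ φ ψ   → Axiom ((φ ∨ ψ) ⊃ (ψ ∨ φ))
    sum  : ∀ φ ψ χ → Axiom ((ψ ⊃ χ) ⊃ ((φ ∨ ψ) ⊃ (φ ∨ χ)))

NameVar PropVar : Set
NameVar = ℕ
PropVar = ℕ

module L₁ where

  infixr 5 _∨_
  infix  7 ∼_
  infix  2 ⊢_

  data Formula : Set where
    ε   : NameVar → NameVar → Formula
    _∨_ : Formula → Formula → Formula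
    ∼_  : Formula → Formula

  open Classical _∨_ ∼_ public

  data ⊢_ : Pred Formula 0ℓ where
    classical : ∀ {φ} → Axiom φ → ⊢ φ
    ax1       : ∀ a b → ⊢ ε a b ⊃ ε a a
    ax2       : ∀ a b c → ⊢ ε a b ∧ ε b c ⊃ ε a c
    ax3       : ∀ a b c → ⊢ ε a b ∧ ε b c ⊃ ε b a
    mp        : ∀ {φ ψ} → ⊢ φ ⊃ ψ → ⊢ φ → ⊢ ψ

module Modal where

  infixr 5 _∨_
  infix  7 ∼_ □_

  data Formula : Set where
    var : PropVar → Formula
    _∨_ : Formula → Formula → Formula
    ∼_  : Formula → Formula
    □_  : Formula → Formula

  open Classical _∨_ ∼_ public

  _[_] : Formula → (PropVar → Formula) → Formula
  var p   [ σ ] = σ p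
  (φ ∨ ψ) [ σ ] = (φ [ σ ]) ∨ (ψ [ σ ])
  (∼ φ)   [ σ ] = ∼ (φ [ σ ])
  (□ φ)   [ σ ] = □ (φ [ σ ])

  data K : Pred Formula 0ℓ where
    classical : ∀ {φ} → Axiom φ → K φ
    distr     : ∀ φ ψ → K (□ (φ ⊃ ψ) ⊃ (□ φ ⊃ □ ψ))
    mp        : ∀ {φ ψ} → K (φ ⊃ ψ) → K φ → K ψ
    nec       : ∀ {φ} → K φ → K (□ φ)

  record IsNormal (X : Pred Formula a) : Set a where
    field
      contains-K : K ⊆ X
      mp-closed  : ∀ {φ ψ} → (φ ⊃ ψ) ∈ X → φ ∈ X → ψ ∈ X
      sub-closed : ∀ {φ} (σ : PropVar → Formula) → φ ∈ X → (φ [ σ ]) ∈ X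
      nec-closed : ∀ {φ} → φ ∈ X → (□ φ) ∈ X

open Modal using (IsNormal) public

-- The first argument is the assignment a ↦ p_a.
B : NameVar ↣ PropVar → L₁.Formula → Modal.Formula
B p (L₁.ε a b) = p[ a ] ∧ □ (p[ a ] ⊃ p[ b ]) ∧ (p[ b ] ⊃ □ (p[ b ] ⊃ p[ a ]))
  where
  open Modal
  p[_] : NameVar → Modal.Formula
  p[ c ] = var (Injection.to p c)
B p (φ L₁.∨ ψ) = B p φ Modal.∨ B p ψ
B p (L₁.∼ φ)   = Modal.∼ B p φ

Faithful : NameVar ↣ PropVar → Pred Modal.Formula a → Set a
Faithful p X = ∀ φ → B p φ ∈ X → L₁.⊢ φ

record Frame ℓ : Set (lsuc ℓ) where
  field
    World : Set ℓ
    _R_   : Rel World ℓ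

open Frame using (World) public

-- Kripke semantics is classical: the double negations at variables and
-- disjunctions make every w ⊩ φ stable, so that K is sound without assuming
-- excluded middle. Under excluded middle they vanish and the clauses are the
-- usual ones.
module _ (𝓕 : Frame ℓ) (V : PropVar → Pred (World 𝓕) ℓ) where
  open Frame 𝓕 using (_R_)
  open Modal

  _⊩_ : World 𝓕 → Formula → Set ℓ
  w ⊩ var p   = ¬ ¬ V p w
  w ⊩ (φ ∨ ψ) = ¬ ¬ (w ⊩ φ ⊎ w ⊩ ψ)
  w ⊩ (∼ φ)   = ¬ w ⊩ φ
  w ⊩ (□ φ)   = ∀ v → w R v → v ⊩ φ

_⊨_ : Frame ℓ → Modal.Formula → Set (lsuc ℓ)
𝓕 ⊨ χ = ∀ V w → _⊩_ 𝓕 V w χ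

-- Sets of frames are given as indexed families.
Complete : {I : Set a} {x : Level} → Pred Modal.Formula x → (I → Frame ℓ) → Set (a ⊔ x ⊔ lsuc ℓ)
Complete X F = ∀ χ → χ ∈ X ⇔ (∀ α → F α ⊨ χ)

_⊆ᶠ_ : {I : Set a} {b : Level} {J : Set b} → (J → Frame ℓ) → (I → Frame ℓ) → Set (a ⊔ b ⊔ lsuc ℓ)
H ⊆ᶠ F = ∀ j → ∃[ α ] F α ≡ H j

Infinite : Set ℓ → Set ℓ
Infinite A = ∀ n → ¬ (A ↔ Fin n)

data Point (i : ℕ) : Set where
  ∗ : Point i
  g : Fin (suc i) → Point i
  η : ℕ → Point i

data Edge {i : ℕ} : Rel (Point i) 0ℓ where
  ∗→g : ∀ j → Edge ∗ (g j)
  g→g : ∀ {j k} → j ≢ k → 1 ≤ toℕ j → 1 ≤ toℕ k → Edge (g j) (g k)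
  η→η : ∀ n → Edge (η n) (η n)

-- 𝓕 is the frame (G*ᵢ , R*ᵢ) for some choice of pairwise distinct elements
-- ∗, g₀, …, gᵢ, ηᵢ₀, ηᵢ₁, … exhausting its set of worlds.
record IsStarFrame (i : ℕ) (𝓕 : Frame ℓ) : Set ℓ where
  open Frame 𝓕 using (_R_)
  field
    points : Point i ↔ World 𝓕
    edges  : ∀ {x y} → Edge x y ⇔ (Inverse.to points x R Inverse.to points y)

module Submission where

open import Data.Empty using (⊥)
open import Data.Fin using (Fin; zero; suc; toℕ; fromℕ<; combine; remQuot)
open import Data.Fin.Properties using (toℕ-injective; toℕ-fromℕ<; remQuot-combine; sequence)
open import Data.Nat using (ℕ; suc; _≤_; _⊔_; s≤s)
open import Data.Nat.Properties using (≤-refl; m⊔n≤o⇒m≤o; m⊔n≤o⇒n≤o)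
open import Data.Product using (_×_; ∃-syntax; _,_; proj₁; proj₂)
open import Data.Sum using (_⊎_; inj₁; inj₂; [_,_]′)
open import Data.Sum.Effectful.Right using (applicative)
open import Data.Unit using (⊤; tt)
open import Function using (_∘_; const; id)
open import Function.Bundles using (_↣_; Equivalence; Injection; Inverse)
open import Level using (Level; Lift; lift; 0ℓ)
open import Relation.Binary using (Rel)
open import Relation.Binary.PropositionalEquality using (_≡_; refl; sym; trans; cong; subst; subst₂)
open import Relation.Nullary using (¬_; contradiction)
open import Relation.Unary using (Pred; _⊆_)
open import Defs

-- If φ has name variables below n, split on all atoms εab with a, b < n: it
-- suffices to derive φ in every theory T extending L₁ that decides them. Let
-- E a b say that T contains εab. Unless T is inconsistent, E obeys the three
-- axioms, and then the star frame with i = n - 1 and the valuation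
--   p_b true at g_c iff E c b,   p_b true at ∗ iff E b b
-- makes B(εab) true at ∗ iff E a b (for the direction from left to right look at
-- the world g_a). Hence T decides φ according to the truth value of B(φ)
-- at ∗, which is true as B(φ) is valid in the star frames.

private variable
  ℓ ℓ′ : Level

open L₁ hiding (mp)

-- Classical theories and case distinction.

record IsTheory (T : Pred Formula 0ℓ) : Set where
  field
    axiom : Axiom ⊆ T
    mp    : ∀ {φ ψ} → T (φ ⊃ ψ) → T φ → T ψ

module TheoryProperties {T : Pred Formula 0ℓ} (isTheory : IsTheory T) where
  open IsTheory isTheory public

  ⊃-trans : ∀ {φ ψ χ} → T (φ ⊃ ψ) → T (ψ ⊃ χ) → T (φ ⊃ χ)
  ⊃-trans f h = mp (mp (axiom (sum _ _ _)) h) f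

  ⊃-refl : ∀ {φ} → T (φ ⊃ φ)
  ⊃-refl = ⊃-trans (axiom (add _ _)) (axiom (taut _))

  ∨-introˡ : ∀ {φ ψ} → T (φ ⊃ φ ∨ ψ)
  ∨-introˡ = axiom (add _ _)

  ∨-introʳ : ∀ {φ ψ} → T (ψ ⊃ φ ∨ ψ)
  ∨-introʳ = ⊃-trans ∨-introˡ (axiom (perm _ _))

  ∨-elim : ∀ {φ ψ χ} → T (φ ⊃ χ) → T (ψ ⊃ χ) → T (φ ∨ ψ ⊃ χ)
  ∨-elim f h =
    ⊃-trans (mp (axiom (sum _ _ _)) h)
      (⊃-trans (axiom (perm _ _))
        (⊃-trans (mp (axiom (sum _ _ _)) f) (axiom (taut _))))

  weaken : ∀ {φ ψ} → T ψ → T (φ ⊃ ψ)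
  weaken = mp ∨-introʳ

  exchange : ∀ {φ ψ χ} → T (φ ⊃ ψ ⊃ χ) → T (ψ ⊃ φ ⊃ χ)
  exchange =
    mp (∨-elim (⊃-trans ∨-introˡ ∨-introʳ)
               (∨-elim ∨-introˡ (⊃-trans ∨-introʳ ∨-introʳ)))

  excluded-middle : ∀ {φ} → T (φ ∨ ∼ φ)
  excluded-middle = mp (axiom (perm _ _)) ⊃-refl

  ∼∼-intro : ∀ {φ} → T φ → T (∼ ∼ φ)
  ∼∼-intro = mp excluded-middle

  explosion : ∀ {φ ψ} → T φ → T (∼ φ) → T ψ
  explosion t n = mp (mp ∨-introˡ n) t

  ∼∨-intro : ∀ {φ ψ} → T (∼ φ) → T (∼ ψ) → T (∼ (φ ∨ ψ))
  -- Each disjunct implies `∼ (φ ∨ ψ)`, so `φ ∨ ψ` implies its own negation, which `taut` contracts.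
  ∼∨-intro n m = mp (axiom (taut _)) (∨-elim (mp ∨-introˡ n) (mp ∨-introˡ m))

  -- By the deduction theorem this is `T` with `φ` adjoined.
  relativise : ∀ φ → IsTheory (λ ψ → T (φ ⊃ ψ))
  relativise φ = record
    { axiom = weaken ∘ axiom
    ; mp    = λ f → mp (∨-elim ∨-introˡ (exchange f))
    }

-- Induction on `k`: adjoin the first atom or its negation, then join the branches by excluded
-- middle. Some branches may be inconsistent.
by-cases : ∀ {T φ k} → IsTheory T → (atoms : Fin k → Formula) →
           (∀ {T′} → IsTheory T′ → T ⊆ T′ →
             (∀ j → T′ (atoms j) ⊎ T′ (∼ atoms j)) → T′ φ) →
           T φ
by-cases {k = ℕ.zero} isTheory atoms f = f isTheory id λ ()
by-cases {T} {φ} {suc k} isTheory atoms f =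
  mp (∨-elim (branch (atoms zero) inj₁) (branch (∼ atoms zero) inj₂)) excluded-middle
  where
  open TheoryProperties isTheory
  branch : ∀ χ → (∀ {T′ : Pred Formula 0ℓ} → T′ χ → T′ (atoms zero) ⊎ T′ (∼ atoms zero)) →
           T (χ ⊃ φ)
  branch χ decide = by-cases (relativise χ) (atoms ∘ suc) λ isTheory′ sub d →
    f isTheory′ (sub ∘ weaken) λ where
      zero    → decide (sub ⊃-refl)
      (suc j) → d j

-- Agreement of derivability with truth.

Agrees : Pred Formula 0ℓ → Formula → Set ℓ → Set ℓ
Agrees T φ P = (T φ × P) ⊎ (T (∼ φ) × ¬ P)

module AgreesProperties {T : Pred Formula 0ℓ} (isTheory : IsTheory T) where
  open TheoryProperties isTheory

  -- The second map is weaker than `Q → P`; this matters because forcing yields `E` only up to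
  -- double negation.
  agrees-map : ∀ {φ} {P : Set ℓ} {Q : Set ℓ′} → (P → Q) → (¬ P → ¬ Q) →
               Agrees T φ P → Agrees T φ Q
  agrees-map f h (inj₁ (t , x)) = inj₁ (t , f x)
  agrees-map f h (inj₂ (n , x)) = inj₂ (n , h x)

  agrees-∼ : ∀ {φ} {P : Set ℓ} → Agrees T φ P → Agrees T (∼ φ) (¬ P)
  agrees-∼ (inj₁ (t , x)) = inj₂ (∼∼-intro t , λ ¬x → ¬x x)
  agrees-∼ (inj₂ a)       = inj₁ a

  agrees-∨ : ∀ {φ ψ} {P Q : Set ℓ} → Agrees T φ P → Agrees T ψ Q → Agrees T (φ ∨ ψ) (P ⊎ Q)
  agrees-∨ (inj₁ (t , x)) _              = inj₁ (mp ∨-introˡ t , inj₁ x)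
  agrees-∨ (inj₂ _)       (inj₁ (t , y)) = inj₁ (mp ∨-introʳ t , inj₂ y)
  agrees-∨ (inj₂ (n , x)) (inj₂ (m , y)) = inj₂ (∼∨-intro n m , [ x , y ]′)

  agrees-⊃ : ∀ {φ ψ} {P Q : Set ℓ} → Agrees T φ P → Agrees T ψ Q → Agrees T (φ ⊃ ψ) (P → Q)
  agrees-⊃ a b = agrees-map
    [ (λ ¬x x → contradiction x ¬x) , const ]′
    (λ n f → n (inj₁ λ x → n (inj₂ (f x))))
    (agrees-∨ (agrees-∼ a) b)

  agrees-∧ : ∀ {φ ψ} {P Q : Set ℓ} → Agrees T φ P → Agrees T ψ Q → Agrees T (φ ∧ ψ) (P × Q)
  agrees-∧ (inj₁ (t , x)) (inj₁ (u , y)) = inj₁ (∼∨-intro (∼∼-intro t) (∼∼-intro u) , x , y)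
  agrees-∧ (inj₁ _)       (inj₂ (n , y)) = inj₂ (∼∼-intro (mp ∨-introʳ n) , y ∘ proj₂)
  agrees-∧ (inj₂ (n , x)) _              = inj₂ (∼∼-intro (mp ∨-introˡ n) , x ∘ proj₁)

  -- If a member of `T` is false, `T` refutes it as well and so contains every formula, in
  -- particular the one to be derived.
  holds-or-trivial : ∀ {φ χ} {P : Set ℓ} → Agrees T φ P → T φ → P ⊎ T χ
  holds-or-trivial (inj₁ (_ , x)) _ = inj₁ x
  holds-or-trivial (inj₂ (n , _)) t = inj₂ (explosion t n)

  decided⇒agrees : ∀ {φ} (d : T φ ⊎ T (∼ φ)) → Agrees T φ ([ const ⊤ , const ⊥ ]′ d)
  decided⇒agrees (inj₁ t) = inj₁ (t , tt)
  decided⇒agrees (inj₂ n) = inj₂ (n , λ ())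

⊢-isTheory : IsTheory ⊢_
⊢-isTheory = record { axiom = classical ; mp = L₁.mp }

-- Formulas in finitely many names.

data Over (n : ℕ) : Pred Formula 0ℓ where
  ε   : (a b : Fin n) → Over n (ε (toℕ a) (toℕ b))
  _∨_ : ∀ {φ ψ} → Over n φ → Over n ψ → Over n (φ ∨ ψ)
  ∼_  : ∀ {φ} → Over n φ → Over n (∼ φ)

maxName : Formula → ℕ
maxName (ε a b) = a ⊔ b
maxName (φ ∨ ψ) = maxName φ ⊔ maxName ψ
maxName (∼ φ)   = maxName φ

over : ∀ {m} φ → maxName φ ≤ m → Over (suc m) φ
over (ε a b) h = subst₂ (λ x y → Over _ (ε x y)) (toℕ-fromℕ< a<) (toℕ-fromℕ< b<)
                        (ε (fromℕ< a<) (fromℕ< b<))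
  where
  a< = s≤s (m⊔n≤o⇒m≤o a b h)
  b< = s≤s (m⊔n≤o⇒n≤o a b h)
over (φ ∨ ψ) h = over φ (m⊔n≤o⇒m≤o (maxName φ) _ h) ∨ over ψ (m⊔n≤o⇒n≤o (maxName φ) _ h)
over (∼ φ)   h = ∼ over φ h

-- Stated for a single triple, so that `laws-or-trivial` can run through the finitely many triples.
record L₁Laws {A : Set} (E : Rel A 0ℓ) (a b c : A) : Set where
  field
    law₁ : E a b → E a a
    law₂ : E a b × E b c → E a c
    law₃ : E a b × E b c → E b a

-- Kripke models on star frames.

module Forcing {ℓ} (𝓕 : Frame ℓ) (V : PropVar → Pred (World 𝓕) ℓ) where

  infix 4 _⊩′_

  _⊩′_ : World 𝓕 → Modal.Formula → Set ℓ
  _⊩′_ = _⊩_ 𝓕 V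

  ⊩-stable : ∀ φ {w} → ¬ ¬ (w ⊩′ φ) → w ⊩′ φ
  ⊩-stable (Modal.var x) h = λ n → h λ x → x n
  ⊩-stable (φ Modal.∨ ψ) h = λ n → h λ x → x n
  ⊩-stable (Modal.∼ φ)   h = λ x → h λ n → n x
  ⊩-stable (Modal.□ φ)   h = λ v r → ⊩-stable φ λ n → h λ f → n (f v r)

  ⊩-⊃-intro : ∀ φ ψ {w} → (w ⊩′ φ → w ⊩′ ψ) → w ⊩′ (φ Modal.⊃ ψ)
  ⊩-⊃-intro φ ψ f n = n (inj₁ λ x → n (inj₂ (f x)))

  ⊩-⊃-elim : ∀ φ ψ {w} → w ⊩′ (φ Modal.⊃ ψ) → w ⊩′ φ → w ⊩′ ψ
  ⊩-⊃-elim φ ψ f x = ⊩-stable ψ λ n → f [ (λ m → m x) , n ]′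

  ⊩-∧-intro : ∀ φ ψ {w} → w ⊩′ φ → w ⊩′ ψ → w ⊩′ (φ Modal.∧ ψ)
  ⊩-∧-intro φ ψ x y n = n [ (λ m → m x) , (λ m → m y) ]′

  ⊩-∧-elim : ∀ φ ψ {w} → w ⊩′ (φ Modal.∧ ψ) → w ⊩′ φ × w ⊩′ ψ
  ⊩-∧-elim φ ψ h = ⊩-stable φ (λ n → h λ k → k (inj₁ n))
                 , ⊩-stable ψ (λ n → h λ k → k (inj₂ n))

module StarModel {ℓ} (p : NameVar ↣ PropVar) {i} (𝓕 : Frame ℓ) (star : IsStarFrame i 𝓕)
                 (E : Rel (Fin (suc i)) 0ℓ) (laws : ∀ a b c → L₁Laws E a b c) where
  open Frame 𝓕 using (_R_)
  open IsStarFrame star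
  open Inverse points using (to; from; strictlyInverseˡ; strictlyInverseʳ)
  open module Laws {a b c} = L₁Laws (laws a b c)

  variableOf : Fin (suc i) → PropVar
  variableOf a = Injection.to p (toℕ a)

  variableOf-injective : ∀ {a b} → variableOf a ≡ variableOf b → a ≡ b
  variableOf-injective = toℕ-injective ∘ Injection.injective p

  Extension : Fin (suc i) → Pred (Point i) 0ℓ
  Extension a ∗     = E a a
  Extension a (g c) = E c a
  -- A default value: `∗` sees only the worlds `g c`.
  Extension a (η _) = ⊥

  -- The existential avoids deciding whether `q` belongs to one of the names; if it does not, it is
  -- false everywhere.
  V : PropVar → Pred (World 𝓕) ℓ
  V q w = Lift ℓ (∃[ a ] variableOf a ≡ q × Extension a (from w))

  open Forcing 𝓕 V

  ⟨_⟩ : Fin (suc i) → Modal.Formula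
  ⟨ a ⟩ = Modal.var (variableOf a)

  infix 7 _⊑_
  -- At `∗` this expresses, up to double negation, that `E c a` implies `E c b` for all `c`.
  _⊑_ : Fin (suc i) → Fin (suc i) → Modal.Formula
  a ⊑ b = Modal.□ (⟨ a ⟩ Modal.⊃ ⟨ b ⟩)

  ⊩-var-intro : ∀ {a x} → Extension a x → to x ⊩′ ⟨ a ⟩
  ⊩-var-intro {a} {x} e n =
    n (lift (a , refl , subst (Extension a) (sym (strictlyInverseʳ x)) e))

  ⊩-var-elim : ∀ {a x} → to x ⊩′ ⟨ a ⟩ → ¬ ¬ Extension a x
  ⊩-var-elim {a} {x} h n = h λ (lift (b , eq , e)) →
    n (subst₂ Extension (variableOf-injective eq) (strictlyInverseʳ x) e)

  Edge-∗ : ∀ {x : Point i} → Edge ∗ x → ∃[ c ] x ≡ g c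
  Edge-∗ (∗→g c) = c , refl

  ⊩-□-intro : ∀ φ → (∀ c → to (g c) ⊩′ φ) → to ∗ ⊩′ (Modal.□ φ)
  ⊩-□-intro φ f v r
    with Edge-∗ (Equivalence.from edges (subst (to ∗ R_) (sym (strictlyInverseˡ v)) r))
  ... | c , eq = subst (_⊩′ φ) (trans (cong to (sym eq)) (strictlyInverseˡ v)) (f c)

  ⊩-⊑-intro : ∀ a b → (∀ c → E c a → E c b) → to ∗ ⊩′ a ⊑ b
  ⊩-⊑-intro a b f = ⊩-□-intro (⟨ a ⟩ Modal.⊃ ⟨ b ⟩) λ c → ⊩-⊃-intro ⟨ a ⟩ ⟨ b ⟩ λ h →
    ⊩-stable ⟨ b ⟩ λ n → ⊩-var-elim {a} {g c} h λ e → n (⊩-var-intro {b} {g c} (f c e))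

  ⊩-⊑-elim : ∀ a b → to ∗ ⊩′ a ⊑ b → ∀ c → E c a → ¬ ¬ E c b
  ⊩-⊑-elim a b h c e =
    ⊩-var-elim {b} {g c}
      (⊩-⊃-elim ⟨ a ⟩ ⟨ b ⟩ (h (to (g c)) (Equivalence.to edges (∗→g c)))
        (⊩-var-intro {a} {g c} e))

  ⊩-ε-intro : ∀ a b → E a b → to ∗ ⊩′ B p (ε (toℕ a) (toℕ b))
  ⊩-ε-intro a b e =
    ⊩-∧-intro ⟨ a ⟩ (a ⊑ b Modal.∧ ⟨b⟩⊃b⊑a) (⊩-var-intro {a} {∗} (law₁ {c = b} e))
      (⊩-∧-intro (a ⊑ b) ⟨b⟩⊃b⊑a
        (⊩-⊑-intro a b λ c e′ → law₂ (e′ , e))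
        (⊩-⊃-intro ⟨ b ⟩ (b ⊑ a) λ h → ⊩-stable (b ⊑ a) λ n → ⊩-var-elim {b} {∗} h λ e′ →
          -- Truth of `⟨ b ⟩` at `∗` means `E b b`; with `E a b` the third axiom gives `E b a`, and
          -- transitivity does the rest.
          n (⊩-⊑-intro b a λ c e″ → law₂ (e″ , law₃ (e , e′)))))
    where ⟨b⟩⊃b⊑a = ⟨ b ⟩ Modal.⊃ b ⊑ a

  -- The first conjunct gives `E a a`, so `⟨ a ⟩` is true at `g a`; the inclusion `a ⊑ b` makes
  -- `⟨ b ⟩` true there, which is `E a b`.
  ⊩-ε-elim : ∀ a b → to ∗ ⊩′ B p (ε (toℕ a) (toℕ b)) → ¬ ¬ E a b
  ⊩-ε-elim a b h n with ⊩-∧-elim ⟨ a ⟩ (a ⊑ b Modal.∧ (⟨ b ⟩ Modal.⊃ b ⊑ a)) h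
  ... | h₁ , h₂ = ⊩-var-elim {a} {∗} h₁ λ e →
    ⊩-⊑-elim a b (proj₁ (⊩-∧-elim (a ⊑ b) (⟨ b ⟩ Modal.⊃ b ⊑ a) h₂)) a e n

  module _ {T} (isTheory : IsTheory T)
           (agrees : ∀ a b → Agrees T (ε (toℕ a) (toℕ b)) (E a b)) where
    open AgreesProperties isTheory

    agrees-B : ∀ {φ} → Over (suc i) φ → Agrees T φ (to ∗ ⊩′ B p φ)
    agrees-B (ε a b) = agrees-map (⊩-ε-intro a b) (λ n h → ⊩-ε-elim a b h n) (agrees a b)
    agrees-B (o ∨ o′) =
      agrees-map (λ x k → k x) (λ n nn → nn n) (agrees-∨ (agrees-B o) (agrees-B o′))
    agrees-B (∼ o) = agrees-∼ (agrees-B o)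

    valid⇒∈ : ∀ {φ} → Over (suc i) φ → 𝓕 ⊨ B p φ → T φ
    valid⇒∈ o valid with agrees-B o
    ... | inj₁ (t , _) = t
    ... | inj₂ (_ , n) = contradiction (valid V (to ∗)) n

-- From validity to derivability.

laws-or-trivial : ∀ {T n φ} {E : Rel (Fin n) 0ℓ} → IsTheory T → ⊢_ ⊆ T →
                  (∀ a b → Agrees T (ε (toℕ a) (toℕ b)) (E a b)) →
                  (∀ a b c → L₁Laws E a b c) ⊎ T φ
laws-or-trivial {T} {n} {φ} {E} isTheory ⊢⊆T agrees =
  -- As `Fin n` is finite, the alternative `T φ` can be pulled out of each quantifier.
  sequence F λ a → sequence F λ b → sequence F λ c → laws a b c
  where
  open AgreesProperties isTheory
  F = applicative 0ℓ (T φ)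
  laws : ∀ a b c → L₁Laws E a b c ⊎ T φ
  laws a b c
    with holds-or-trivial (agrees-⊃ (agrees a b) (agrees a a)) (⊢⊆T (ax1 _ _))
       | holds-or-trivial (agrees-⊃ (agrees-∧ (agrees a b) (agrees b c)) (agrees a c)) (⊢⊆T (ax2 _ _ _))
       | holds-or-trivial (agrees-⊃ (agrees-∧ (agrees a b) (agrees b c)) (agrees b a)) (⊢⊆T (ax3 _ _ _))
  ... | inj₁ l₁ | inj₁ l₂ | inj₁ l₃ = inj₁ record { law₁ = l₁ ; law₂ = l₂ ; law₃ = l₃ }
  ... | inj₂ t  | _       | _       = inj₂ t
  ... | _       | inj₂ t  | _       = inj₂ t
  ... | _       | _       | inj₂ t  = inj₂ t

star-valid⇒⊢ : ∀ (p : NameVar ↣ PropVar) {i φ} {𝓕 : Frame ℓ} → IsStarFrame i 𝓕 →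
               Over (suc i) φ → 𝓕 ⊨ B p φ → ⊢ φ
star-valid⇒⊢ p {i} {φ} {𝓕} star o valid = by-cases ⊢-isTheory (atom ∘ remQuot {n} n) derive
  where
  n = suc i
  atom : Fin n × Fin n → Formula
  atom (a , b) = ε (toℕ a) (toℕ b)
  derive : ∀ {T} → IsTheory T → ⊢_ ⊆ T →
           (∀ j → T (atom (remQuot {n} n j)) ⊎ T (∼ atom (remQuot {n} n j))) → T φ
  derive {T} isTheory ⊢⊆T decide =
    [ (λ laws → StarModel.valid⇒∈ p 𝓕 star E laws isTheory agrees o valid) , id ]′
      (laws-or-trivial isTheory ⊢⊆T agrees)
    where
    decide′ : ∀ a b → T (atom (a , b)) ⊎ T (∼ atom (a , b))
    decide′ a b = subst (λ q → T (atom q) ⊎ T (∼ atom q)) (remQuot-combine a b) (decide (combine a b))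
    -- Read off the decision, not membership in `T`: a refuted atom must be false even if an
    -- inconsistent `T` also contains it.
    E : Rel (Fin n) 0ℓ
    E a b = [ const ⊤ , const ⊥ ]′ (decide′ a b)
    agrees : ∀ a b → Agrees T (atom (a , b)) (E a b)
    agrees a b = AgreesProperties.decided⇒agrees isTheory (decide′ a b)

theorem7p1 : ∀ {x a ℓ} (p : NameVar ↣ PropVar)
    (X : Pred Modal.Formula x) → IsNormal X →
    (I : Set a) → ℕ ↣ I →
    (F : I → Frame ℓ) → (∀ α → World (F α) × Infinite (World (F α))) →
    Complete X F →
    (H : ℕ → Frame ℓ) → (∀ i → IsStarFrame i (H i)) →
    H ⊆ᶠ F →
    Faithful p X
-- The star frame with this index has one world `g c` for each name from 0 to `maxName φ`.
theorem7p1 p X _ I _ F _ complete H star H⊆F φ Bφ∈X with H⊆F (maxName φ)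
... | α , eq = star-valid⇒⊢ p (star (maxName φ)) (over φ ≤-refl)
                 (subst (_⊨ B p φ) eq (Equivalence.to (complete (B p φ)) Bφ∈X α))
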